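{- There exist constants $c>0$ and $N_0$ such that for every $N\ge N_0$ that is a power of two there exists an interval graph $G=(V,E)$ with $|V|=N$ nodes satisfying the following. When the nodes are labeled $v_0,\dots,v_{N-1}$ in increasing order of the left endpoints of their intervals, the minimal $\pi$-OBDD representing $\chi_E$ has at least $c\,N\log N$ nodes, where $\pi$ is the $2$-interleaved variable order with decreasing significance.
   Context: An interval graph on $N$ nodes is given by intervals $[a_i,b_i]$ with $a_i<b_i$, $0\le i\le N-1$; two distinct nodes are adjacent iff their intervals intersect. Without loss of generality all $2N$ endpoints are distinct, so the left endpoints determine a unique labeling $v_0,\dots,v_{N-1}$ with $a_0<a_1<\dots<a_{N-1}$. Let $n=\lceil\log_2 N\rceil$. For $x=(x_0,\dots,x_{n-1})\in\{0,1\}^n$ put $|x|=\sum_{i=0}^{n-1}x_i2^i$. The characteristic function $\chi_E:\{0,1\}^{2n}\to\{0,1\}$ is defined by $\chi_E(x,y)=1$ iff $|x|,|y|<N$ and $\{v_{|x|},v_{|y|}\}\in E$. A $\pi$-OBDD for a variable order $\pi$ (a linear order of the input variables) is a directed acyclic rooted graph with two sinks labeled $0$ and $1$. Every inner node is labeled by a variable and has two outgoing edges labeled $0$ and $1$, and along every edge the variables respect $\pi$. An assignment determines a path from the root by following, at each node labeled $x_i$, the edge labeled by the value of $x_i$. The OBDD represents $f$ if this path always ends in the sink labeled $f(\text{assignment})$. The size of an OBDD is its number of nodes. The $2$-interleaved variable order with decreasing significance on $x,y\in\{0,1\}^n$ is $(x_{n-1},y_{n-1},x_{n-2},y_{n-2},\dots,x_0,y_0)$.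 -}

module Defs where

open import Level using (0ℓ)
open import Data.Bool.Base using (Bool; true; false; if_then_else_)
open import Data.Fin.Base as Fin using (Fin; toℕ; fromℕ<)
open import Data.Fin.Patterns using (0F; 1F)
import Data.Fin.Properties as Fin
open import Data.Integer.Base using (+_)
open import Data.Nat.Base as ℕ using (ℕ; _+_; _*_; _^_)
import Data.Nat.Properties as ℕ
open import Data.Nat.Logarithm using (⌈log₂_⌉)
open import Data.Product.Base using (_×_; _,_; ∃-syntax)
open import Data.Product.Relation.Binary.Lex.Strict
  using (×-Lex; ×-isStrictTotalOrder)
open import Data.Product.Relation.Binary.Pointwise.NonDependent
  using (≡×≡⇒≡; ≡⇒≡×≡)
open import Data.Rational.Base as ℚ using (ℚ)
import Data.Rational.Properties as ℚ
open import Data.Sum.Base using (inj₁; inj₂)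
open import Data.Vec.Functional using (Vector)
open import Function.Base using (flip; _∘_)
open import Relation.Binary.Core using (Rel)
open import Relation.Binary.Definitions using (tri<; tri≈; tri>)
open import Relation.Binary.Structures using (IsStrictTotalOrder)
open import Relation.Binary.Structures.Biased using (isStrictTotalOrderᶜ)
import Relation.Binary.Construct.Flip.EqAndOrd as Flip
open import Relation.Binary.PropositionalEquality
  using (_≡_; _≢_; isEquivalence)
open import Relation.Nullary using (Dec; yes; no; does; ¬?; _×-dec_; map′)
open import Algebra.Properties.CommutativeMonoid.Sum ℕ.+-0-commutativeMonoid
  using (sum-syntax)

ℕ→ℚ : ℕ → ℚ
ℕ→ℚ m = + m ℚ./ 1

-- Finitely many intervals can be moved to rational endpoints without changing
-- the relative order of the endpoints, so ℚ stands in for the real line.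
record IntervalGraph (N : ℕ) : Set where
  field
    a b         : Fin N → ℚ
    a<b         : ∀ i → a i ℚ.< b i
    a-injective : ∀ {i j} → a i ≡ a j → i ≡ j
    b-injective : ∀ {i j} → b i ≡ b j → i ≡ j
    a≢b         : ∀ i j → a i ≢ b j

  _∈I_ : ℚ → Fin N → Set
  p ∈I i = a i ℚ.≤ p × p ℚ.≤ b i

  Intersect : Rel (Fin N) 0ℓ
  Intersect i j = ∃[ p ] (p ∈I i × p ∈I j)

  Adjacent : Rel (Fin N) 0ℓ
  Adjacent i j = i ≢ j × Intersect i j

  intersect? : ∀ i j → Dec (Intersect i j)
  intersect? i j = map′ to from ((a i ℚ.≤? b j) ×-dec (a j ℚ.≤? b i))
    where
    to : a i ℚ.≤ b j × a j ℚ.≤ b i → Intersect i j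
    to (ai≤bj , aj≤bi) with ℚ.≤-total (a i) (a j)
    ... | inj₁ ai≤aj =
      a j , (ai≤aj , aj≤bi) , (ℚ.≤-refl , ℚ.<⇒≤ (a<b j))
    ... | inj₂ aj≤ai =
      a i , (ℚ.≤-refl , ℚ.<⇒≤ (a<b i)) , (aj≤ai , ai≤bj)

    from : Intersect i j → a i ℚ.≤ b j × a j ℚ.≤ b i
    from (_ , (ai≤p , p≤bi) , (aj≤p , p≤bj)) =
      ℚ.≤-trans ai≤p p≤bj , ℚ.≤-trans aj≤p p≤bi

  adjacent? : ∀ i j → Dec (Adjacent i j)
  adjacent? i j = ¬? (i Fin.≟ j) ×-dec intersect? i j

-- The element i of Fin N is then the node v_i.
LabeledByLeftEndpoints : ∀ {N} → IntervalGraph N → Set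
LabeledByLeftEndpoints G = ∀ {i j} → i Fin.< j → a i ℚ.< a j
  where open IntervalGraph G

-- The least significant bit has index 0.
∣_∣ : ∀ {n} → Vector Bool n → ℕ
∣_∣ {n} x = ∑[ i < n ] ((if x i then 1 else 0) * 2 ^ toℕ i)

χE : ∀ {N} → IntervalGraph N →
     Vector Bool ⌈log₂ N ⌉ → Vector Bool ⌈log₂ N ⌉ → Bool
χE {N} G x y with ∣ x ∣ ℕ.<? N | ∣ y ∣ ℕ.<? N
... | yes x<N | yes y<N =
  does (IntervalGraph.adjacent? G (fromℕ< x<N) (fromℕ< y<N))
... | _       | _       = false

record VariableOrder (V : Set) : Set₁ where
  field
    _≺_                : Rel V 0ℓ
    isStrictTotalOrder : IsStrictTotalOrder _≡_ _≺_

data Node (k : ℕ) : Set where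
  sink  : Bool → Node k
  inner : Fin k → Node k

-- Acyclicity is a consequence of `ordered`: the variable strictly increases
-- along every edge between inner nodes.
record OBDD {V : Set} (π : VariableOrder V) : Set where
  open VariableOrder π
  field
    #inner  : ℕ
    root    : Node #inner
    var     : Fin #inner → V
    edge    : Fin #inner → Bool → Node #inner
    ordered : ∀ {u w} c → edge u c ≡ inner w → var u ≺ var w

  size : ℕ
  size = #inner + 2

  data EndsIn (α : V → Bool) : Node #inner → Bool → Set where
    stop : ∀ {r} → EndsIn α (sink r) r
    step : ∀ {u r} → EndsIn α (edge u (α (var u))) r → EndsIn α (inner u) r

  Represents : ((V → Bool) → Bool) → Set
  Represents f = ∀ α → EndsIn α root (f α)

-- The pair (i , 0F) is the variable x_i and (i , 1F) is y_i.
Var : ℕ → Set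
Var n = Fin n × Fin 2

onVars : ∀ {n} → (Vector Bool n → Vector Bool n → Bool) →
         (Var n → Bool) → Bool
onVars f α = f (λ i → α (i , 0F)) (λ i → α (i , 1F))

-- x_{n-1}, y_{n-1}, …, x_0, y_0: larger indices first, and x_i before y_i.
interleavedOrder : ∀ n → VariableOrder (Var n)
interleavedOrder n = record
  { _≺_                = ×-Lex _≡_ (flip Fin._<_) Fin._<_
  ; isStrictTotalOrder = isStrictTotalOrderᶜ record
    { isEquivalence = isEquivalence
    ; trans         = Lex.trans
    ; compare       = compare
    }
  }
  where
  module Lex = IsStrictTotalOrder
    (×-isStrictTotalOrder
      (Flip.isStrictTotalOrder (Fin.<-isStrictTotalOrder {n}))
      (Fin.<-isStrictTotalOrder {2}))

  compare : ∀ u v → _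
  compare u v with Lex.compare u v
  ... | tri< u<v u≉v u≯v = tri< u<v (u≉v ∘ ≡⇒≡×≡) u≯v
  ... | tri≈ u≮v u≈v u≯v = tri≈ u≮v (≡×≡⇒≡ u≈v) u≯v
  ... | tri> u≮v u≉v u>v = tri> u≮v (u≉v ∘ ≡⇒≡×≡) u>v

{-# OPTIONS --safe #-}
-- Nodes reached after reading different prefixes of the variable order are
-- different if they compute different subfunctions, and a subfunction that
-- depends on the next variable has a node labelled by that variable. So it is
-- enough to find, for Ω(log N) bit positions m, Ω(N) prefixes with distinct
-- subfunctions depending on x_m.
--
-- A prefix that ends just before x_m selects a block of the adjacency matrix,
-- of side S = 2^(m+1), where √N ≥ S > 2^d ≥ log N for d about (log N)/4. The
-- rows are taken in the lower half of the nodes, the columns in the upper half.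
-- In each block row h, the even rows end in pairwise different block columns, so
-- every even row is the only nonconstant even row of its block. Hence the block
-- determines the position of that row modulo S. The odd rows are constant on all
-- blocks and spell out h in binary, so the block also determines h: every even
-- row yields a subfunction of its own.
module Submission where

open import Defs
open import Algebra.Properties.CommutativeMonoid.Sum using (sum-cong-≗)
import Algebra.Properties.Semiring.Sum as SemiringSum
open import Data.Bool.Base using (Bool; true; false; if_then_else_; T)
open import Data.Fin.Base as Fin using (Fin; toℕ; fromℕ<; remQuot; combine)
open import Data.Fin.Patterns using (0F; 1F)
open import Data.Fin.Properties
  using (toℕ-injective; toℕ<n; toℕ-fromℕ<; combine-remQuot; injective⇒≤)
open import Data.Integer.Base as ℤ using (+≤+; +<+)
import Data.Integer.Properties as ℤ
open import Data.Nat.Base hiding (compare)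
open import Data.Nat.Coprimality as Coprimality using (1-coprimeTo)
open import Data.Nat.Divisibility using (_∣_; divides; divides-refl)
open import Data.Nat.DivMod
open import Data.Nat.Logarithm using (⌈log₂_⌉; ⌈log₂2^n⌉≡n)
open import Data.Nat.Properties
open import Data.Nat.Tactic.RingSolver using (solve-∀)
open import Data.Product.Base
  using (_×_; _,_; ∃-syntax; Σ-syntax; proj₁; uncurry)
open import Data.Rational.Base as ℚ using (ℚ; 0ℚ; mkℚ; *≤*; *<*)
import Data.Rational.Properties as ℚ
import Data.Rational.Unnormalised.Base as ℚᵘ
import Data.Rational.Unnormalised.Properties as ℚᵘ
open import Data.Sum.Base using (inj₁; inj₂)
open import Data.Unit.Base using (⊤; tt)
open import Data.Vec.Functional using (Vector)
open import Function.Base using (_∘_)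
open import Function.Bundles using (_⇔_; mk⇔)
open import Relation.Binary.Definitions using (tri<; tri≈; tri>)
open import Relation.Binary.PropositionalEquality
open import Relation.Binary.Structures using (IsStrictTotalOrder)
open import Relation.Nullary using (¬_; yes; no; does; contradiction)
open import Relation.Nullary.Decidable using (does-⇔; dec-true; dec-false)

-- Subfunctions of an OBDD

module Subfunctions {V : Set} (π : VariableOrder V) (B : OBDD π) where
  open VariableOrder π
  open IsStrictTotalOrder isStrictTotalOrder using (compare)
    renaming (_<?_ to _≺?_; trans to ≺-trans; irrefl to ≺-irrefl)
  open OBDD B

  endsIn-unique : ∀ {α v r s} → EndsIn α v r → EndsIn α v s → r ≡ s
  endsIn-unique stop     stop     = refl
  endsIn-unique (step p) (step q) = endsIn-unique p q

  -- A sink tests nothing, so it satisfies the condition vacuously. For an up-closed `P` the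
  -- condition passes to all nodes below, since variables increase along edges.
  Reads : (V → Set) → Node #inner → Set
  Reads P (sink _)  = ⊤
  Reads P (inner u) = P (var u)

  UpClosed : (V → Set) → Set
  UpClosed P = ∀ {x y} → P x → x ≺ y → P y

  reads-edge : ∀ {P} → UpClosed P → ∀ u c → P (var u) → Reads P (edge u c)
  reads-edge up u c pu with edge u c in eq
  ... | sink _  = tt
  ... | inner w = up pu (ordered c eq)

  endsIn-local : ∀ {P} → UpClosed P → ∀ {α β v r} →
                 (∀ x → P x → α x ≡ β x) → Reads P v →
                 EndsIn α v r → EndsIn β v r
  endsIn-local up α≈β pv stop = stop
  endsIn-local up {α} {β} α≈β pv (step {u} p) = step
    (subst (λ c → EndsIn β (edge u c) _) (α≈β _ pv)
      (endsIn-local up α≈β (reads-edge up u _ pv) p))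

  -- The path is cut at the first node whose label is not before `x`. All tests up to there concern
  -- variables before `x`, so every assignment agreeing with `α` on these arrives at the same node.
  reach : ∀ x {α v r} → EndsIn α v r →
          ∃[ w ] (Reads (λ y → ¬ y ≺ x) w ×
            (∀ β → (∀ y → y ≺ x → β y ≡ α y) →
             ∀ {s} → EndsIn β v s → EndsIn β w s))
  reach x (stop {r}) = sink r , tt , λ _ _ p → p
  reach x {α} (step {u} p) with var u ≺? x
  ... | no  u⊀x = inner u , u⊀x , λ _ _ q → q
  ... | yes u≺x with reach x p
  ...   | w , rw , follow = w , rw , λ where
          β β≈α (step q) → follow β β≈α
            (subst (λ c → EndsIn β (edge u c) _) (β≈α _ u≺x) q)

  module Represented {f} (represents : Represents f) where

    -- If the node reached were not labelled x, then x would never be read below it.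
    reach-labelled : ∀ x (α : V → Bool) {β γ} →
      (∀ y → y ≢ x → γ y ≡ β y) → (∀ y → y ≺ x → β y ≡ α y) → f β ≢ f γ →
      ∃[ u ] (var u ≡ x ×
        (∀ β → (∀ y → y ≺ x → β y ≡ α y) → EndsIn β (inner u) (f β)))
    reach-labelled x α {β} {γ} γ≈β β≈α fβ≢fγ with reach x (represents α)
    ... | w , rw , follow = labelled w rw λ β′ β′≈α → follow β′ β′≈α (represents β′)
      where
      γ≈α : ∀ y → y ≺ x → γ y ≡ α y
      γ≈α y y≺x = trans (γ≈β y (λ y≡x → ≺-irrefl y≡x y≺x)) (β≈α y y≺x)

      unread : ∀ w → Reads (x ≺_) w →
        (∀ β → (∀ y → y ≺ x → β y ≡ α y) → EndsIn β w (f β)) → f β ≡ f γ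
      unread w x≺w ends = endsIn-unique
        (endsIn-local {x ≺_} (λ x≺y y≺z → ≺-trans x≺y y≺z)
          (λ y x≺y → sym (γ≈β y (λ y≡x → ≺-irrefl (sym y≡x) x≺y)))
          x≺w (ends β β≈α))
        (ends γ γ≈α)

      labelled : ∀ w → Reads (λ y → ¬ y ≺ x) w →
        (∀ β → (∀ y → y ≺ x → β y ≡ α y) → EndsIn β w (f β)) →
        ∃[ u ] (var u ≡ x ×
          (∀ β → (∀ y → y ≺ x → β y ≡ α y) → EndsIn β (inner u) (f β)))
      labelled w rw ends with w
      ... | sink _ = contradiction (unread _ _ ends) fβ≢fγ
      ... | inner u with compare (var u) x
      ...   | tri< u≺x _ _ = contradiction u≺x rw
      ...   | tri≈ _ u≡x _ = u , u≡x , ends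
      ...   | tri> _ _ x≺u = contradiction (unread _ x≺u ends) fβ≢fγ

    -- Essentiality provides index `s` with a node labelled `x s`. If two indices share a node,
    -- their labels coincide, and any common continuation leads from it to the same sink, so the
    -- subfunctions agree. Since `x` may vary with `s`, several levels are counted at once.
    distinctSubfunctions≤ : ∀ {K} (x : Fin K → V) (α : Fin K → V → Bool) →
      (∀ s → ∃[ β ] ∃[ γ ] ((∀ y → y ≢ x s → γ y ≡ β y) ×
        (∀ y → y ≺ x s → β y ≡ α s y) × f β ≢ f γ)) →
      (∀ s t → x s ≡ x t →
        (∀ β γ → (∀ y → y ≺ x s → β y ≡ α s y) →
                 (∀ y → y ≺ x s → γ y ≡ α t y) →
                 (∀ y → ¬ y ≺ x s → β y ≡ γ y) → f β ≡ f γ) →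
        s ≡ t) →
      K ≤ #inner
    distinctSubfunctions≤ x α essential separated = injective⇒≤ {f = proj₁ ∘ node} inj
      where
      node : ∀ s → ∃[ u ] (var u ≡ x s ×
        (∀ β → (∀ y → y ≺ x s → β y ≡ α s y) → EndsIn β (inner u) (f β)))
      node s with essential s
      ... | β , γ , γ≈β , β≈α , fβ≢fγ = reach-labelled (x s) (α s) γ≈β β≈α fβ≢fγ

      inj : ∀ {s t} → proj₁ (node s) ≡ proj₁ (node t) → s ≡ t
      inj {s} {t} eq with node s | node t | eq
      ... | u , u≡s , ends | _ , u≡t , ends′ | refl =
        separated s t xs≡xt λ β γ β≈α γ≈α β≈γ →
          endsIn-unique
            (endsIn-local {λ y → ¬ y ≺ x s} (λ y⊀x y≺z z≺x → y⊀x (≺-trans y≺z z≺x))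
              β≈γ (λ u≺s → ≺-irrefl u≡s u≺s) (ends β β≈α))
            (ends′ γ (subst (λ z → ∀ y → y ≺ z → γ y ≡ α t y) xs≡xt γ≈α))
        where
        xs≡xt = trans (sym u≡s) u≡t

-- Binary expansions

bit : ℕ → ℕ → Bool
bit zero    u = u % 2 ≡ᵇ 1
bit (suc p) u = bit p (u / 2)

bits : ∀ n → ℕ → Vector Bool n
bits n u i = bit (toℕ i) u

[m+2n]/2 : ∀ m n → (m + n * 2) / 2 ≡ m / 2 + n
[m+2n]/2 m n = trans (+-distrib-/-∣ʳ m (divides-refl n)) (cong (m / 2 +_) (m*n/n≡m n 2))

ε+2n-/2 : ∀ {ε} n → ε < 2 → (ε + n * 2) / 2 ≡ n
ε+2n-/2 {ε} n ε<2 = trans ([m+2n]/2 ε n) (cong (_+ n) (m<n⇒m/n≡0 ε<2))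

m*2^[1+k] : ∀ m k → m * 2 ^ suc k ≡ m * 2 ^ k * 2
m*2^[1+k] m k = lemma m (2 ^ k)
  where
  lemma : ∀ m x → m * (2 * x) ≡ m * x * 2
  lemma = solve-∀

-- Halving turns `c + h * 2 ^ k` into `c / 2` plus `h` times the next smaller power, so the block
-- number `h` stays out of reach for `k` halvings.
bit-low : ∀ {p k} c h → p < k → bit p (c + h * 2 ^ k) ≡ bit p c
bit-low {zero}  {suc k} c h _ rewrite m*2^[1+k] h k =
  cong (_≡ᵇ 1) ([m+kn]%n≡m%n c (h * 2 ^ k) 2)
bit-low {suc p} {suc k} c h (s≤s p<k) rewrite m*2^[1+k] h k | [m+2n]/2 c (h * 2 ^ k) =
  bit-low (c / 2) h p<k

bit-high : ∀ {p k c} h → k ≤ p → c < 2 ^ k → bit p (c + h * 2 ^ k) ≡ bit (p ∸ k) h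
bit-high {p}     {zero}  {c} h _ (s≤s z≤n) = cong (bit p) (*-identityʳ h)
bit-high {suc p} {suc k} {c} h (s≤s k≤p) c<2^k
  rewrite m*2^[1+k] h k | [m+2n]/2 c (h * 2 ^ k) =
  bit-high h k≤p (m<n*o⇒m/o<n (subst (c <_) (*-comm 2 (2 ^ k)) c<2^k))

∣bits∣ : ∀ n {u} → u < 2 ^ n → ∣ bits n u ∣ ≡ u
∣bits∣ zero    u<1 = sym (n<1⇒n≡0 u<1)
∣bits∣ (suc n) {u} u<2^[1+n] = begin
  head * 1 + sum {n} (λ i → value (bit (toℕ i) (u / 2)) * 2 ^ suc (toℕ i))
    ≡⟨ cong₂ _+_ (*-identityʳ head) (sum-cong-≗ +-0-commutativeMonoid {n} λ i →
         m*2^[1+k] (value (bit (toℕ i) (u / 2))) (toℕ i)) ⟩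
  head + sum {n} (λ i → value (bit (toℕ i) (u / 2)) * 2 ^ toℕ i * 2)
    ≡⟨ cong (head +_) (*-distribʳ-sum {n} 2 (λ i → value (bit (toℕ i) (u / 2)) * 2 ^ toℕ i)) ⟨
  head + ∣ bits n (u / 2) ∣ * 2
    ≡⟨ cong₂ (λ x y → x + y * 2) (value-%2 (u % 2) (m%n<n u 2))
         (∣bits∣ n (m<n*o⇒m/o<n (subst (u <_) (*-comm 2 (2 ^ n)) u<2^[1+n]))) ⟩
  u % 2 + u / 2 * 2
    ≡⟨ m≡m%n+[m/n]*n u 2 ⟨
  u ∎
  where
  open ≡-Reasoning
  open SemiringSum +-*-semiring using (sum; *-distribʳ-sum)
  value : Bool → ℕ
  value b = if b then 1 else 0
  head = value (bit 0 u)
  value-%2 : ∀ r → r < 2 → value (r ≡ᵇ 1) ≡ r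
  value-%2 0 _ = refl
  value-%2 1 _ = refl
  value-%2 (suc (suc _)) (s≤s (s≤s ()))

bits-injective : ∀ {n u v} → u < 2 ^ n → v < 2 ^ n →
                 (∀ p → p < n → bit p u ≡ bit p v) → u ≡ v
bits-injective {n} {u} {v} u< v< eq = begin
  u             ≡⟨ ∣bits∣ n u< ⟨
  ∣ bits n u ∣  ≡⟨ sum-cong-≗ +-0-commutativeMonoid {n} (λ i →
                     cong (λ b → (if b then 1 else 0) * 2 ^ toℕ i) (eq (toℕ i) (toℕ<n i))) ⟩
  ∣ bits n v ∣  ≡⟨ ∣bits∣ n v< ⟩
  v             ∎
  where open ≡-Reasoning

-- Interval graphs from last neighbours

ℕ→ℚ-normal : ∀ m → ℕ→ℚ m ≡ mkℚ (ℤ.+ m) 0 (Coprimality.sym (1-coprimeTo m))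
ℕ→ℚ-normal m = ℚ.↥p/↧p≡p (mkℚ (ℤ.+ m) 0 _)

ℕ→ℚ-mono-≤ : ∀ {m n} → m ≤ n → ℕ→ℚ m ℚ.≤ ℕ→ℚ n
ℕ→ℚ-mono-≤ {m} {n} m≤n rewrite ℕ→ℚ-normal m | ℕ→ℚ-normal n =
  *≤* (ℤ.*-monoʳ-≤-nonNeg (ℤ.+ 1) (+≤+ m≤n))

ℕ→ℚ-mono-< : ∀ {m n} → m < n → ℕ→ℚ m ℚ.< ℕ→ℚ n
ℕ→ℚ-mono-< {m} {n} m<n rewrite ℕ→ℚ-normal m | ℕ→ℚ-normal n =
  *<* (ℤ.*-monoʳ-<-pos (ℤ.+ 1) (+<+ m<n))

ℕ→ℚ-cancel-≤ : ∀ {m n} → ℕ→ℚ m ℚ.≤ ℕ→ℚ n → m ≤ n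
ℕ→ℚ-cancel-≤ {m} {n} p = ≮⇒≥ λ n<m → ℚ.<-irrefl refl (ℚ.<-≤-trans (ℕ→ℚ-mono-< n<m) p)

ℕ→ℚ-injective : ∀ m n → ℕ→ℚ m ≡ ℕ→ℚ n → m ≡ n
ℕ→ℚ-injective m n eq = ≤-antisym (ℕ→ℚ-cancel-≤ {m} {n} (ℚ.≤-reflexive eq))
                                 (ℕ→ℚ-cancel-≤ {n} {m} (ℚ.≤-reflexive (sym eq)))

-- The comparison is made in the unnormalised rationals, where the product is not reduced and
-- clearing denominators leaves the given inequality.
1/-*-≤ : ∀ q {m} n → m ≤ n * suc q → mkℚ (ℤ.+ 1) q (1-coprimeTo (suc q)) ℚ.* ℕ→ℚ m ℚ.≤ ℕ→ℚ n
1/-*-≤ q {m} n m≤n*q rewrite ℕ→ℚ-normal m | ℕ→ℚ-normal n =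
  ℚ.toℚᵘ-cancel-≤ (ℚᵘ.≤-respˡ-≃ (ℚᵘ.≃-sym (ℚ.toℚᵘ-homo-* (mkℚ (ℤ.+ 1) q (1-coprimeTo (suc q)))
                                                  (mkℚ (ℤ.+ m) 0 (Coprimality.sym (1-coprimeTo m)))))
    (ℚᵘ.*≤* lemma))
  where
  lemma : (ℤ.+ 1 ℤ.* ℤ.+ m) ℤ.* ℤ.+ 1 ℤ.≤ ℤ.+ n ℤ.* ℤ.+ (suc q * 1)
  lemma rewrite ℤ.*-identityʳ (ℤ.+ 1 ℤ.* ℤ.+ m) | ℤ.*-identityˡ (ℤ.+ m) | *-identityʳ (suc q)
    | sym (ℤ.pos-* n (suc q)) = +≤+ m≤n*q

-- Interval i ends just behind the left endpoint number r i. The scale K leaves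
-- room for the offsets 1 + i, which keep all endpoints distinct.
module FromLastNeighbour {N} (r : ℕ → ℕ) (i≤ri : ∀ i → i < N → i ≤ r i) where
  K : ℕ
  K = suc N

  right : ℕ → ℕ
  right i = suc i + r i * K

  right%K : ∀ {i} → i < N → right i % K ≡ suc i
  right%K {i} i<N = trans ([m+kn]%n≡m%n (suc i) (r i) K) (m<n⇒m%n≡m (s≤s i<N))

  left≤right : ∀ {i j} → j ≤ r i → j * K ≤ right i
  left≤right {i} j≤ri = ≤-trans (*-monoˡ-≤ K j≤ri) (m≤n+m _ (suc i))

  -- The offset `suc i` is at most `N`, hence less than `K`: the right endpoint stays before left
  -- endpoint number `r i + 1`.
  left≤right⁻¹ : ∀ {i j} → i < N → j * K ≤ right i → j ≤ r i
  left≤right⁻¹ {i} {j} i<N p = ≮⇒≥ λ ri<j → <⇒≱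
    (<-≤-trans (+-monoˡ-< (r i * K) (s≤s i<N)) (*-monoˡ-≤ K ri<j)) p

  graph : IntervalGraph N
  graph = record
    { a           = λ i → ℕ→ℚ (toℕ i * K)
    ; b           = λ i → ℕ→ℚ (right (toℕ i))
    ; a<b         = λ i → ℕ→ℚ-mono-<
        (s≤s (≤-trans (*-monoˡ-≤ K (i≤ri (toℕ i) (toℕ<n i))) (m≤n+m _ (toℕ i))))
    ; a-injective = λ {i} {j} eq →
        toℕ-injective (*-cancelʳ-≡ (toℕ i) (toℕ j) K (ℕ→ℚ-injective (toℕ i * K) (toℕ j * K) eq))
    ; b-injective = λ {i} {j} eq → toℕ-injective (suc-injective (trans
        (sym (right%K (toℕ<n i)))
        (trans (cong (_% K) (ℕ→ℚ-injective (right (toℕ i)) (right (toℕ j)) eq))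
               (right%K (toℕ<n j)))))
    ; a≢b         = λ i j eq → 0≢1+n (trans
        (sym (m*n%n≡0 (toℕ i) K))
        (trans (cong (_% K) (ℕ→ℚ-injective (toℕ i * K) (right (toℕ j)) eq))
               (right%K (toℕ<n j))))
    }

  open IntervalGraph graph

  labeled : LabeledByLeftEndpoints graph
  labeled i<j = ℕ→ℚ-mono-< (*-monoˡ-< K i<j)

  -- As `a i` is smaller than `a j`, the two intervals meet exactly if the second starts before the
  -- first ends, and then `a j` is a common point.
  adjacent⇔ : ∀ {i j} → i Fin.< j → Adjacent i j ⇔ toℕ j ≤ r (toℕ i)
  adjacent⇔ {i} {j} i<j = mk⇔
    (λ { (_ , _ , (_ , p≤bi) , (aj≤p , _)) →
      left≤right⁻¹ (toℕ<n i) (ℕ→ℚ-cancel-≤ (ℚ.≤-trans aj≤p p≤bi)) })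
    (λ j≤ri → (λ i≡j → <-irrefl (cong toℕ i≡j) i<j) , a j ,
      (ℚ.<⇒≤ (labeled i<j) , ℕ→ℚ-mono-≤ (left≤right j≤ri)) ,
      (ℚ.≤-refl , ℚ.<⇒≤ (a<b j)))

  χE-< : ∀ {x y u v} → ∣ x ∣ ≡ u → ∣ y ∣ ≡ v → u < v → v < N →
         χE graph x y ≡ (v ≤ᵇ r u)
  χE-< {x} {y} {u} {v} refl refl u<v v<N with ∣ x ∣ <? N | ∣ y ∣ <? N
  ... | no u≮N  | _       = contradiction (<-trans u<v v<N) u≮N
  ... | yes _   | no v≮N  = contradiction v<N v≮N
  ... | yes u<N | yes v<N = begin
    does (adjacent? (fromℕ< u<N) (fromℕ< v<N))
      ≡⟨ does-⇔ (adjacent⇔ (subst₂ _<_ (sym (toℕ-fromℕ< u<N)) (sym (toℕ-fromℕ< v<N)) u<v))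
           (adjacent? (fromℕ< u<N) (fromℕ< v<N)) (_ ≤? _) ⟩
    (toℕ (fromℕ< v<N) ≤ᵇ r (toℕ (fromℕ< u<N)))
      ≡⟨ cong₂ (λ w z → w ≤ᵇ r z) (toℕ-fromℕ< v<N) (toℕ-fromℕ< u<N) ⟩
    (∣ y ∣ ≤ᵇ r ∣ x ∣) ∎
    where open ≡-Reasoning

-- The hard graphs

≤ᵇ-true : ∀ {m n} → m ≤ n → (m ≤ᵇ n) ≡ true
≤ᵇ-true {m} {n} = dec-true (m ≤? n)

≤ᵇ-false : ∀ {m n} → n < m → (m ≤ᵇ n) ≡ false
≤ᵇ-false {m} {n} n<m = dec-false (m ≤? n) (<⇒≱ n<m)

≤ᵇ-true⁻¹ : ∀ {m n} → (m ≤ᵇ n) ≡ true → m ≤ n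
≤ᵇ-true⁻¹ {m} {n} eq = ≤ᵇ⇒≤ m n (subst T (sym eq) _)

≤ᵇ-false⁻¹ : ∀ {m n} → (m ≤ᵇ n) ≡ false → n < m
≤ᵇ-false⁻¹ {m} {n} eq = ≰⇒> λ m≤n → contradiction (trans (sym (≤ᵇ-true m≤n)) eq) λ ()

c+h*s<k*s : ∀ {c h k} s → c < s → h < k → c + h * s < k * s
c+h*s<k*s {h = h} s c<s h<k = <-≤-trans (+-monoˡ-< (h * s) c<s) (*-monoˡ-≤ s h<k)

2^-split : ∀ {k m} → k ≤ m → 2 ^ m ≡ 2 ^ (m ∸ k) * 2 ^ k
2^-split {k} {m} k≤m = trans (cong (2 ^_) (sym (m∸n+n≡m k≤m))) (^-distribˡ-+-* 2 (m ∸ k) k)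

bit-≥ : ∀ {p k c} → k ≤ p → c < 2 ^ k → bit p c ≡ bit (p ∸ k) 0
bit-≥ {p} {k} {c} k≤p c<2^k = trans (cong (bit p) (sym (+-identityʳ c))) (bit-high 0 k≤p c<2^k)

bit-odd : ∀ p → bit 0 (1 + p * 2) ≡ true
bit-odd p = cong (_≡ᵇ 1) ([m+kn]%n≡m%n 1 p 2)

bit-even : ∀ p → bit 0 (p * 2) ≡ false
bit-even p = cong (_≡ᵇ 1) ([m+kn]%n≡m%n 0 p 2)

-- In `l = c + b * 2 ^ m` the digit `b` is 0 or 1 and is replaced by `1 ∸ b`. Lower bits come from
-- `c`; above `m` both numbers have only zeros.
flipBit : ∀ m {l} → l < 2 ^ suc m →
  ∃[ l* ] (l* < 2 ^ suc m × l* ≢ l × (∀ p → p ≢ m → bit p l* ≡ bit p l))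
flipBit m {l} l<S = c + (1 ∸ b) * s
                  , c+h*s<k*s s c<s (s≤s (m∸n≤m 1 b))
                  , (λ eq → 1∸b≢b b (*-cancelʳ-≡ _ _ s (+-cancelˡ-≡ c _ _ (trans eq l≡))))
                  , flipped
  where
  s = 2 ^ m
  instance
    s≢0 : NonZero s
    s≢0 = m^n≢0 2 m
  b = l / s
  c = l % s
  l≡ : l ≡ c + b * s
  l≡ = m≡m%n+[m/n]*n l s
  c<s : c < s
  c<s = m%n<n l s
  1∸b≢b : ∀ b → 1 ∸ b ≢ b
  1∸b≢b zero          ()
  1∸b≢b (suc zero)    ()
  1∸b≢b (suc (suc _)) ()
  flipped : ∀ p → p ≢ m → bit p (c + (1 ∸ b) * s) ≡ bit p l
  flipped p p≢m with <-cmp p m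
  ... | tri< p<m _ _ = trans (bit-low c (1 ∸ b) p<m)
                         (sym (trans (cong (bit p) l≡) (bit-low c b p<m)))
  ... | tri≈ _ p≡m _ = contradiction p≡m p≢m
  ... | tri> _ _ m<p = trans (bit-≥ m<p (c+h*s<k*s s c<s (s≤s (m∸n≤m 1 b))))
                         (sym (bit-≥ m<p l<S))

-- The nodes are the numbers below 2 * H. An odd node u < H is adjacent to all
-- or to none of the nodes above H, according to one bit of u; the code bits of
-- the odd nodes in an aligned block spell out the position of the block.
module Construction (d w : ℕ) where
  -- Numbers have `κ + 2` bits, and there are `2 ^ κ` even rows below `H`. The upper half has room
  -- for `Q` end positions at spacing `step`.
  κ = d + d + w
  H = 2 ^ suc κ
  Q = 2 ^ (d + d)
  step = 2 ^ suc w

  instance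
    Q≢0 : NonZero Q
    Q≢0 = m^n≢0 2 (d + d)
    2^d≢0 : NonZero (2 ^ d)
    2^d≢0 = m^n≢0 2 d

  H≡Q*step : H ≡ Q * step
  H≡Q*step = trans (cong (2 ^_) (sym (+-suc (d + d) w))) (^-distribˡ-+-* 2 (d + d) (suc w))

  -- Halving numbers the odd nodes consecutively, so in each aligned run of `2 ^ suc d` nodes every
  -- bit position below `2 ^ d` is displayed by one odd node.
  codeBit : ℕ → Bool
  codeBit u = bit ((u / 2) % 2 ^ d) u

  -- The value `2 * H` lies behind all nodes, and the value `u` means no later neighbour.
  lastNeighbour : ℕ → ℕ
  lastNeighbour u =
    if u <ᵇ H
    then (if bit 0 u then (if codeBit u then 2 * H else u) else H + u % Q * step)
    else u

  ≤lastNeighbour : ∀ u → u ≤ lastNeighbour u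
  ≤lastNeighbour u with u <ᵇ H in u<H | bit 0 u | codeBit u
  ... | false | _     | _     = ≤-refl
  ... | true  | true  | false = ≤-refl
  ... | true  | true  | true  =
    ≤-trans (<⇒≤ (<ᵇ⇒< u H (subst T (sym u<H) _))) (m≤m+n H _)
  ... | true  | false | _     =
    ≤-trans (<⇒≤ (<ᵇ⇒< u H (subst T (sym u<H) _))) (m≤m+n H _)

  lastNeighbour-even : ∀ {u} → u < H → bit 0 u ≡ false → lastNeighbour u ≡ H + u % Q * step
  lastNeighbour-even {u} u<H even rewrite dec-true (u <? H) u<H | even = refl

  lastNeighbour-odd : ∀ {u} → u < H → bit 0 u ≡ true →
                      lastNeighbour u ≡ (if codeBit u then 2 * H else u)
  lastNeighbour-odd {u} u<H odd rewrite dec-true (u <? H) u<H | odd = refl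

  -- Blocks have side `S`. By `d≤m` a block contains a code row for every position below `2 ^ d`, by
  -- `m<2d` its side divides `Q`, and with `2d≤1+w` it divides `step`. The lower half consists of
  -- `η` block rows.
  module Level (m : ℕ) (d≤m : d ≤ m) (m<2d : m < d + d) (2d≤1+w : d + d ≤ suc w) where
    S = 2 ^ suc m
    τ = 2 ^ (suc w ∸ suc m)
    η = Q * τ

    instance
      S≢0 : NonZero S
      S≢0 = m^n≢0 2 (suc m)
      τ≢0 : NonZero τ
      τ≢0 = m^n≢0 2 (w ∸ m)

    step≡τ*S : step ≡ τ * S
    step≡τ*S = 2^-split (≤-trans m<2d 2d≤1+w)

    H≡η*S : H ≡ η * S
    H≡η*S = trans H≡Q*step (trans (cong (Q *_) step≡τ*S) (sym (*-assoc Q τ S)))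

    S∣Q : S ∣ Q
    S∣Q = divides (2 ^ (d + d ∸ suc m)) (2^-split m<2d)

    1<S : 1 < S
    1<S = *-monoʳ-≤ 2 (m^n>0 2 m)

    0<S : 0 < S
    0<S = <-trans z<s 1<S

    c+h*S<H : ∀ {c h} → c < S → h < η → c + h * S < H
    c+h*S<H c<S h<η = <-≤-trans (c+h*s<k*s S c<S h<η) (≤-reflexive (sym H≡η*S))

    -- H and step are multiples of S, so the last neighbour of an even row is the
    -- first column of a block, namely of block number col l h for row l + h * S.
    col : ℕ → ℕ → ℕ
    col l h = η + (l + h * S) % Q * τ

    col*S : ∀ l h → col l h * S ≡ H + (l + h * S) % Q * step
    col*S l h = begin
      (η + x * τ) * S      ≡⟨ *-distribʳ-+ S η (x * τ) ⟩
      η * S + x * τ * S    ≡⟨ cong₂ _+_ (sym H≡η*S) (*-assoc x τ S) ⟩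
      H + x * (τ * S)      ≡⟨ cong (λ s → H + x * s) step≡τ*S ⟨
      H + x * step         ∎
      where
      open ≡-Reasoning
      x = (l + h * S) % Q

    -- Since `S` divides `Q`, reduction modulo `Q` preserves the residue modulo `S`, which is the
    -- offset `l`.
    col-injective : ∀ {l l′} h → l < S → l′ < S → col l h ≡ col l′ h → l ≡ l′
    col-injective {l} {l′} h l<S l′<S eq = begin
      l                      ≡⟨ mod l<S ⟨
      (l + h * S) % Q % S    ≡⟨ cong (_% S) (*-cancelʳ-≡ _ _ τ (+-cancelˡ-≡ η _ _ eq)) ⟩
      (l′ + h * S) % Q % S   ≡⟨ mod l′<S ⟩
      l′                     ∎
      where
      open ≡-Reasoning
      mod : ∀ {l} → l < S → (l + h * S) % Q % S ≡ l
      mod {l} l<S = trans (m∣n⇒o%n%m≡o%m S Q _ S∣Q)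
        (trans ([m+kn]%n≡m%n l h S) (m<n⇒m%n≡m l<S))

    H≤col*S : ∀ c l h → H ≤ c + col l h * S
    H≤col*S c l h = ≤-trans (≤-trans (m≤m+n H _) (≤-reflexive (sym (col*S l h)))) (m≤n+m _ c)

    c+col*S<2H : ∀ {c} l h → c < S → c + col l h * S < 2 * H
    c+col*S<2H {c} l h c<S = begin-strict
      c + col l h * S         <⟨ +-monoˡ-< (col l h * S) c<S ⟩
      S + col l h * S         ≤⟨ +-monoˡ-≤ (col l h * S)
                                   (subst (S ≤_) (sym step≡τ*S) (m≤n*m S τ)) ⟩
      step + col l h * S      ≡⟨ cong (step +_) (col*S l h) ⟩
      step + (H + x * step)   ≡⟨ x∙yz≈y∙xz step H (x * step) ⟩
      H + suc x * step        ≤⟨ +-monoʳ-≤ H (*-monoˡ-≤ step (m%n<n _ Q)) ⟩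
      H + Q * step            ≡⟨ cong (H +_) (trans (sym H≡Q*step) (sym (+-identityʳ H))) ⟩
      2 * H                   ∎
      where
      open ≤-Reasoning
      x = (l + h * S) % Q
      x∙yz≈y∙xz : ∀ a b c → a + (b + c) ≡ b + (a + c)
      x∙yz≈y∙xz = solve-∀

    bit-low-cong : ∀ {p} c h h′ → p ≤ m → bit p (c + h * S) ≡ bit p (c + h′ * S)
    bit-low-cong c h h′ p≤m = trans (bit-low c h (s≤s p≤m)) (sym (bit-low c h′ (s≤s p≤m)))

    bit-high-cong : ∀ {p c c′} h → m < p → c < S → c′ < S →
                    bit p (c + h * S) ≡ bit p (c′ + h * S)
    bit-high-cong h m<p c<S c′<S = trans (bit-high h m<p c<S) (sym (bit-high h m<p c′<S))

    module Rows (F : ℕ → ℕ → Bool)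
      (F≡ : ∀ {u v} → u < H → H ≤ v → v < 2 * H → F u v ≡ (v ≤ᵇ lastNeighbour u)) where

      -- The row ends at the first column of a block. In that block its entry is true at offset 0
      -- and false at all other offsets, which is what makes it nonconstant.
      F-even : ∀ {l h} c̃ l′ h′ → bit 0 l ≡ false → l < S → h < η → c̃ < S →
        F (l + h * S) (c̃ + col l′ h′ * S) ≡ (c̃ + col l′ h′ * S ≤ᵇ col l h * S)
      F-even {l} {h} c̃ l′ h′ even l<S h<η c̃<S = trans
        (F≡ (c+h*S<H l<S h<η) (H≤col*S c̃ l′ h′) (c+col*S<2H l′ h′ c̃<S))
        (cong (c̃ + col l′ h′ * S ≤ᵇ_) (trans
          (lastNeighbour-even (c+h*S<H l<S h<η) (trans (bit-low {k = suc m} l h z<s) even))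
          (sym (col*S l h))))

      codeRow : ℕ → ℕ
      codeRow p = 1 + p * 2

      codeRow<S : ∀ {p} → p < 2 ^ d → codeRow p < S
      codeRow<S {p} p<2^d = begin-strict
        1 + p * 2   <⟨ +-monoˡ-< (p * 2) (s≤s (s≤s z≤n)) ⟩
        suc p * 2   ≤⟨ *-monoˡ-≤ 2 p<2^d ⟩
        2 ^ d * 2   ≤⟨ *-monoˡ-≤ 2 (^-monoʳ-≤ 2 d≤m) ⟩
        2 ^ m * 2   ≡⟨ *-comm (2 ^ m) 2 ⟩
        S           ∎
        where open ≤-Reasoning

      codeBit-codeRow : ∀ p h → p < 2 ^ d →
                        codeBit (codeRow p + h * S) ≡ bit p (codeRow p + h * S)
      codeBit-codeRow p h p<2^d = cong (λ q → bit q (codeRow p + h * S)) (begin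
        (1 + p * 2 + h * S) / 2 % 2 ^ d      ≡⟨ cong (λ x → x / 2 % 2 ^ d) (shape p h (2 ^ m)) ⟩
        (1 + (p + h * 2 ^ m) * 2) / 2 % 2 ^ d
          ≡⟨ cong (_% 2 ^ d) (ε+2n-/2 (p + h * 2 ^ m) (s≤s (s≤s z≤n))) ⟩
        (p + h * 2 ^ m) % 2 ^ d
          -- Because `d ≤ m`, the contribution of the block number is a multiple of `2 ^ d`.
          ≡⟨ cong (λ x → (p + h * x) % 2 ^ d) (2^-split d≤m) ⟩
        (p + h * (2 ^ (m ∸ d) * 2 ^ d)) % 2 ^ d
          ≡⟨ cong (λ x → (p + x) % 2 ^ d) (*-assoc h (2 ^ (m ∸ d)) (2 ^ d)) ⟨
        (p + h * 2 ^ (m ∸ d) * 2 ^ d) % 2 ^ d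
          ≡⟨ [m+kn]%n≡m%n p (h * 2 ^ (m ∸ d)) (2 ^ d) ⟩
        p % 2 ^ d                            ≡⟨ m<n⇒m%n≡m p<2^d ⟩
        p                                    ∎)
        where
        open ≡-Reasoning
        shape : ∀ p h x → 1 + p * 2 + h * (2 * x) ≡ 1 + (p + h * x) * 2
        shape = solve-∀

      -- Both possible last neighbours lie outside the upper half, one behind and one before it, so
      -- the row is constant there.
      F-codeRow : ∀ p {h} l′ h′ → p < 2 ^ d → h < η →
                  F (codeRow p + h * S) (col l′ h′ * S) ≡ bit p (codeRow p + h * S)
      F-codeRow p {h} l′ h′ p<2^d h<η = begin
        F x y                               ≡⟨ F≡ x<H H≤y y<2H ⟩
        y ≤ᵇ lastNeighbour x
          ≡⟨ cong (y ≤ᵇ_) (lastNeighbour-odd x<H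
               (trans (bit-low {k = suc m} (codeRow p) h z<s) (bit-odd p))) ⟩
        y ≤ᵇ (if codeBit x then 2 * H else x)  ≡⟨ select (codeBit x) ⟩
        codeBit x                           ≡⟨ codeBit-codeRow p h p<2^d ⟩
        bit p x                             ∎
        where
        open ≡-Reasoning
        x = codeRow p + h * S
        y = col l′ h′ * S
        x<H : x < H
        x<H = c+h*S<H (codeRow<S p<2^d) h<η
        H≤y : H ≤ y
        H≤y = H≤col*S 0 l′ h′
        y<2H : y < 2 * H
        y<2H = c+col*S<2H {0} l′ h′ 0<S
        select : ∀ b → (y ≤ᵇ (if b then 2 * H else x)) ≡ b
        select true  = ≤ᵇ-true (<⇒≤ y<2H)
        select false = ≤ᵇ-false (<-≤-trans x<H H≤y)

      block-injective : ∀ {n l h l′ h′} → n ≤ 2 ^ d → H ≤ 2 ^ n →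
        bit 0 l ≡ false → bit 0 l′ ≡ false → l < S → l′ < S → h < η → h′ < η →
        (∀ {c c̃} → c < S → c̃ < S →
          F (c + h * S) (c̃ + col l h * S) ≡ F (c + h′ * S) (c̃ + col l′ h′ * S)) →
        l + h * S ≡ l′ + h′ * S
      block-injective {n} {l} {h} {l′} {h′} n≤2^d H≤2^n even even′ l<S l′<S h<η h′<η same =
        bits-injective {n} (<-≤-trans (c+h*S<H l<S h<η) H≤2^n)
                           (<-≤-trans (c+h*S<H l′<S h′<η) H≤2^n) equalBits
        where
        -- Row `l`, not `l′`, is read in the second block. Offsets 0 and 1 then show that it ends at
        -- the first column of this block, exactly where row `l′` ends.
        threshold : ∀ {c̃} → c̃ < S →
          (c̃ + col l h * S ≤ᵇ col l h * S) ≡ (c̃ + col l′ h′ * S ≤ᵇ col l h′ * S)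
        threshold {c̃} c̃<S = trans (sym (F-even c̃ l h even l<S h<η c̃<S))
          (trans (same l<S c̃<S) (F-even c̃ l′ h′ even l<S h′<η c̃<S))

        l≡l′ : l ≡ l′
        l≡l′ = col-injective h′ l<S l′<S (*-cancelʳ-≡ _ _ S (≤-antisym
          (s≤s⁻¹ (≤ᵇ-false⁻¹ (trans (sym (threshold 1<S)) (≤ᵇ-false (n<1+n (col l h * S))))))
          (≤ᵇ-true⁻¹ (trans (sym (threshold 0<S)) (≤ᵇ-true (≤-refl {col l h * S}))))))

        equalBits : ∀ p → p < n → bit p (l + h * S) ≡ bit p (l′ + h′ * S)
        equalBits p p<n with p ≤? m
        ... | yes p≤m = trans (bit-low-cong l h h′ p≤m)
                          (cong (λ l → bit p (l + h′ * S)) l≡l′)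
        ... | no  p≰m = begin
          -- A bit above `m` belongs to `h`, so the offset can be exchanged for `codeRow p`, whose
          -- constant entry on the block is this bit.
          bit p (l + h * S)                       ≡⟨ bit-high-cong h m<p l<S row<S ⟩
          bit p (codeRow p + h * S)               ≡⟨ F-codeRow p l h p<2^d h<η ⟨
          F (codeRow p + h * S) (col l h * S)     ≡⟨ same row<S 0<S ⟩
          F (codeRow p + h′ * S) (col l′ h′ * S)  ≡⟨ F-codeRow p l′ h′ p<2^d h′<η ⟩
          bit p (codeRow p + h′ * S)              ≡⟨ bit-high-cong h′ m<p row<S l′<S ⟩
          bit p (l′ + h′ * S)                     ∎
          where
          open ≡-Reasoning
          m<p = ≰⇒> p≰m
          p<2^d = <-≤-trans p<n n≤2^d
          row<S = codeRow<S p<2^d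

      -- Flipping bit `m` of `l` gives another row of the block; it is again even because `m` is
      -- positive, and so it ends in another block column.
      block-essential : ∀ {l h} → 1 ≤ m → bit 0 l ≡ false → l < S → h < η →
        ∃[ l* ] ∃[ c̃ ] (l* < S × c̃ < S × (∀ p → p ≢ m → bit p l* ≡ bit p l) ×
          F (l + h * S) (c̃ + col l h * S) ≢ F (l* + h * S) (c̃ + col l h * S))
      block-essential {l} {h} 1≤m even l<S h<η with flipBit m l<S
      ... | l* , l*<S , l*≢l , flipped = choose (<-cmp (col l* h * S) (col l h * S))
        where
        open ≡-Reasoning
        even* : bit 0 l* ≡ false
        even* = trans (flipped 0 (λ 0≡m → <-irrefl 0≡m 1≤m)) even

        choose : _ → _
        choose (tri< col*<col _ _) = l* , 0 , l*<S , 0<S , flipped , λ eq →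
          contradiction (begin
            true                                  ≡⟨ ≤ᵇ-true (≤-refl {col l h * S}) ⟨
            (col l h * S ≤ᵇ col l h * S)          ≡⟨ F-even 0 l h even l<S h<η 0<S ⟨
            F (l + h * S) (col l h * S)           ≡⟨ eq ⟩
            F (l* + h * S) (col l h * S)          ≡⟨ F-even 0 l h even* l*<S h<η 0<S ⟩
            (col l h * S ≤ᵇ col l* h * S)         ≡⟨ ≤ᵇ-false col*<col ⟩
            false                                 ∎) λ ()
        choose (tri≈ _ col*≡col _) = contradiction
          (col-injective h l*<S l<S (*-cancelʳ-≡ _ _ S col*≡col)) l*≢l
        -- Here both rows are still true at offset 0; they differ at offset 1, which row `l` no
        -- longer reaches.
        choose (tri> _ _ col<col*) = l* , 1 , l*<S , 1<S , flipped , λ eq →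
          contradiction (begin
            false                                 ≡⟨ ≤ᵇ-false (n<1+n (col l h * S)) ⟨
            (1 + col l h * S ≤ᵇ col l h * S)      ≡⟨ F-even 1 l h even l<S h<η 1<S ⟨
            F (l + h * S) (1 + col l h * S)       ≡⟨ eq ⟩
            F (l* + h * S) (1 + col l h * S)      ≡⟨ F-even 1 l h even* l*<S h<η 1<S ⟩
            (1 + col l h * S ≤ᵇ col l* h * S)     ≡⟨ ≤ᵇ-true col<col* ⟩
            true                                  ∎) λ ()

-- The lower bound

assign : ∀ {n} → Vector Bool n → Vector Bool n → Var n → Bool
assign x y (i , 0F) = x i
assign x y (i , 1F) = y i

24+4q≤2^[5+q] : ∀ q → 24 + q * 4 ≤ 2 ^ (5 + q)
24+4q≤2^[5+q] zero    = m≤m+n 24 8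
24+4q≤2^[5+q] (suc q) = begin
  24 + (4 + q * 4)           ≡⟨ shape q ⟩
  4 + (24 + q * 4)           ≤⟨ +-mono-≤ (m≤m+n 4 (20 + q * 4)) ≤-refl ⟩
  (24 + q * 4) + (24 + q * 4)  ≤⟨ +-mono-≤ (24+4q≤2^[5+q] q) (24+4q≤2^[5+q] q) ⟩
  2 ^ (5 + q) + 2 ^ (5 + q)  ≡⟨ cong (2 ^ (5 + q) +_) (+-identityʳ _) ⟨
  2 ^ (6 + q)                ∎
  where
  open ≤-Reasoning
  shape : ∀ q → 24 + (4 + q * 4) ≡ 4 + (24 + q * 4)
  shape = solve-∀

-- With `d` positive, the constraints imply `4d + 1 ≤ n ≤ 2 ^ d`, hence `d ≥ 5` and `n ≥ 21`. From
-- there on `d` grows by one for every four bits, and `w` absorbs the remainder `ρ`.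
parameters : ∀ {n} → 21 ≤ n →
  ∃[ d ] ∃[ w ] (n ≡ suc (suc (d + d + w)) × 1 ≤ d × d + d ≤ suc w × n ≤ 2 ^ d × n ≤ d * 8)
parameters {n} 21≤n = 5 + q , 9 + ρ + (q + q) , trans n≡ (shape ρ q) , s≤s z≤n , 2d≤1+w ,
  ≤-trans n≤ (24+4q≤2^[5+q] q) , ≤-trans n≤ 24+4q≤
  where
  open ≤-Reasoning
  k = n ∸ 21
  q = k / 4
  ρ = k % 4
  shape : ∀ ρ q → 21 + (ρ + q * 4) ≡ suc (suc ((5 + q) + (5 + q) + (9 + ρ + (q + q))))
  shape = solve-∀
  n≡ : n ≡ 21 + (ρ + q * 4)
  n≡ = trans (sym (m+[n∸m]≡n 21≤n)) (cong (21 +_) (m≡m%n+[m/n]*n k 4))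
  n≤ : n ≤ 24 + q * 4
  n≤ = begin
    n                   ≡⟨ n≡ ⟩
    21 + (ρ + q * 4)    ≤⟨ +-monoʳ-≤ 21 (+-monoˡ-≤ (q * 4) (s≤s⁻¹ (m%n<n k 4))) ⟩
    24 + q * 4          ∎
  2d≤1+w : (5 + q) + (5 + q) ≤ suc (9 + ρ + (q + q))
  2d≤1+w = begin
    (5 + q) + (5 + q)        ≤⟨ m≤m+n _ ρ ⟩
    (5 + q) + (5 + q) + ρ    ≡⟨ shape′ ρ q ⟩
    suc (9 + ρ + (q + q))    ∎
    where
    shape′ : ∀ ρ q → (5 + q) + (5 + q) + ρ ≡ suc (9 + ρ + (q + q))
    shape′ = solve-∀
  24+4q≤ : 24 + q * 4 ≤ (5 + q) * 8
  24+4q≤ = begin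
    24 + q * 4                     ≤⟨ m≤m+n _ (16 + q * 4) ⟩
    24 + q * 4 + (16 + q * 4)      ≡⟨ shape′ q ⟩
    (5 + q) * 8                    ∎
    where
    shape′ : ∀ q → 24 + q * 4 + (16 + q * 4) ≡ (5 + q) * 8
    shape′ = solve-∀

2^-cancel-≤ : ∀ m n → 2 ^ m ≤ 2 ^ n → m ≤ n
2^-cancel-≤ m n 2^m≤2^n = ≮⇒≥ λ n<m → <⇒≱ (^-monoʳ-< 2 (s≤s (s≤s z≤n)) n<m) 2^m≤2^n

module Hardness (d w : ℕ) where
  open Construction d w

  module _
    (1≤d : 1 ≤ d) (2d≤1+w : d + d ≤ suc w) (n≤2^d : suc (suc κ) ≤ 2 ^ d)
    (f : Vector Bool (suc (suc κ)) → Vector Bool (suc (suc κ)) → Bool)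
    (f≡ : ∀ {u v} → u < H → H ≤ v → v < 2 * H →
          f (bits _ u) (bits _ v) ≡ (v ≤ᵇ lastNeighbour u))
    where

    private
      n = suc (suc κ)

    module AtLevel (e : Fin d) where
      m : ℕ
      m = d + toℕ e

      m<2d : m < d + d
      m<2d = +-monoʳ-< d (toℕ<n e)

      m<n : m < n
      m<n = <-≤-trans m<2d (≤-trans (m≤m+n (d + d) w) (m≤n+m κ 2))

      open Level m (m≤m+n d (toℕ e)) m<2d 2d≤1+w public
      open Rows (λ u v → f (bits n u) (bits n v)) f≡ public

      variable-x : Var n
      variable-x = fromℕ< m<n , 0F

      -- The even rows are `toℕ g * 2`, split into the offset in the block and the number of the
      -- block row.
      low high : Fin (2 ^ κ) → ℕ
      low  g = toℕ g * 2 % S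
      high g = toℕ g * 2 / S

      low<S : ∀ g → low g < S
      low<S g = m%n<n (toℕ g * 2) S

      low+high : ∀ g → toℕ g * 2 ≡ low g + high g * S
      low+high g = m≡m%n+[m/n]*n (toℕ g * 2) S

      high<η : ∀ g → high g < η
      high<η g = m<n*o⇒m/o<n (begin-strict
        toℕ g * 2   <⟨ *-monoˡ-< 2 (toℕ<n g) ⟩
        2 ^ κ * 2   ≡⟨ *-comm (2 ^ κ) 2 ⟩
        H           ≡⟨ H≡η*S ⟩
        η * S       ∎)
        where open ≤-Reasoning

      low-even : ∀ g → bit 0 (low g) ≡ false
      low-even g = trans (sym (bit-low {k = suc m} (low g) (high g) z<s))
        (trans (cong (bit 0) (sym (low+high g))) (bit-even (toℕ g)))

      -- Only values before `variable-x` are compared with it. These are the high bits, which select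
      -- the block where row `toℕ g * 2` ends.
      prefix : Fin (2 ^ κ) → Var n → Bool
      prefix g = assign (bits n (low g + high g * S)) (bits n (col (low g) (high g) * S))

    open VariableOrder (interleavedOrder n)

    -- The variable `y_m` comes after `x_m`, so exactly the indices above `m` have been read, for
    -- rows and columns alike. This is why the blocks are square.
    before⇒> : ∀ {k : Fin n} {z : Fin 2} {m} (m<n : m < n) →
               (k , z) ≺ (fromℕ< m<n , 0F) → m < toℕ k
    before⇒> m<n (inj₁ m<k)      = subst (_< _) (toℕ-fromℕ< m<n) m<k
    before⇒> m<n (inj₂ (_ , ()))

    ¬before⇒≤ : ∀ {k : Fin n} {z : Fin 2} {m} (m<n : m < n) →
                ¬ (k , z) ≺ (fromℕ< m<n , 0F) → toℕ k ≤ m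
    ¬before⇒≤ m<n ⊀ = ≮⇒≥ λ m<k → ⊀ (inj₁ (subst (_< _) (sym (toℕ-fromℕ< m<n)) m<k))

    lowerBound : ∀ B → OBDD.Represents B (onVars f) → d * 2 ^ κ ≤ OBDD.#inner B
    lowerBound B represents = distinctSubfunctions≤ (λ s → var (rq s)) (λ s → pre (rq s))
      (λ s → essential (rq s))
      (λ s t eq same → begin
        s                   ≡⟨ combine-remQuot {d} (2 ^ κ) s ⟨
        uncurry combine (rq s)  ≡⟨ cong (uncurry combine) (separated (rq s) (rq t) eq same) ⟩
        uncurry combine (rq t)  ≡⟨ combine-remQuot {d} (2 ^ κ) t ⟩
        t                   ∎)
      where
      open ≡-Reasoning
      open Subfunctions (interleavedOrder n) B using (module Represented)
      open Represented represents

      Index = Fin d × Fin (2 ^ κ)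

      rq : Fin (d * 2 ^ κ) → Index
      rq = remQuot (2 ^ κ)

      var : Index → Var n
      var (e , _) = AtLevel.variable-x e

      pre : Index → Var n → Bool
      pre (e , g) = AtLevel.prefix e g

      essential : ∀ s → ∃[ β ] ∃[ γ ] ((∀ y → y ≢ var s → γ y ≡ β y) ×
        (∀ y → y ≺ var s → β y ≡ pre s y) × onVars f β ≢ onVars f γ)
      essential (e , g) with block-essential (≤-trans 1≤d (m≤m+n d (toℕ e)))
                               (low-even g) (low<S g) (high<η g)
        where open AtLevel e
      ... | l* , c̃ , l*<S , c̃<S , flipped , differ =
        assign (bits n (low g + high g * S)) y , assign (bits n (l* + high g * S)) y ,
        agree , agree-prefix , differ
        where
        open AtLevel e
        y : Vector Bool n
        y = bits n (c̃ + col (low g) (high g) * S)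

        agree : ∀ z → z ≢ variable-x → assign (bits n (l* + high g * S)) y z
                                     ≡ assign (bits n (low g + high g * S)) y z
        agree (k , 1F) _ = refl
        agree (k , 0F) k≢m with toℕ k ≤? m
        ... | no  k≰m = bit-high-cong (high g) (≰⇒> k≰m) l*<S (low<S g)
        ... | yes k≤m = begin
          bit (toℕ k) (l* + high g * S)     ≡⟨ bit-low l* (high g) (s≤s k≤m) ⟩
          bit (toℕ k) l*                    ≡⟨ flipped (toℕ k) (λ k≡m → k≢m (cong (_, 0F)
                                                 (toℕ-injective (trans k≡m (sym (toℕ-fromℕ< m<n)))))) ⟩
          bit (toℕ k) (low g)               ≡⟨ bit-low (low g) (high g) (s≤s k≤m) ⟨
          bit (toℕ k) (low g + high g * S)  ∎

        agree-prefix : ∀ z → z ≺ variable-x →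
          assign (bits n (low g + high g * S)) y z ≡ prefix g z
        agree-prefix (k , 0F) _ = refl
        agree-prefix (k , 1F) k≺m =
          bit-high-cong (col (low g) (high g)) (before⇒> m<n k≺m) c̃<S 0<S

      Confused : Index → Index → Set
      Confused s t = ∀ β γ → (∀ y → y ≺ var s → β y ≡ pre s y) →
                             (∀ y → y ≺ var s → γ y ≡ pre t y) →
                             (∀ y → ¬ y ≺ var s → β y ≡ γ y) → onVars f β ≡ onVars f γ

      separated-at : ∀ e g g′ → Confused (e , g) (e , g′) → g ≡ g′
      separated-at e g g′ same = toℕ-injective (*-cancelʳ-≡ (toℕ g) (toℕ g′) 2 (begin
          toℕ g * 2                  ≡⟨ low+high g ⟩
          low g + high g * S         ≡⟨ block-injective n≤2^d (m≤m+n H _)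
                                          (low-even g) (low-even g′) (low<S g) (low<S g′)
                                          (high<η g) (high<η g′) sameBlock ⟩
          low g′ + high g′ * S       ≡⟨ low+high g′ ⟨
          toℕ g′ * 2                 ∎))
        where
        open AtLevel e

        -- The high bits choose the block of `g`, the low bits the cell in it. Confused prefixes
        -- therefore have equal blocks, cell by cell.
        entry : ℕ → ℕ → Fin (2 ^ κ) → Var n → Bool
        entry c c̃ g = assign (bits n (c + high g * S)) (bits n (c̃ + col (low g) (high g) * S))

        entry-prefix : ∀ {c c̃} g → c < S → c̃ < S → ∀ z → z ≺ variable-x →
                       entry c c̃ g z ≡ prefix g z
        entry-prefix g c<S c̃<S (k , 0F) k≺m =
          bit-high-cong (high g) (before⇒> m<n k≺m) c<S (low<S g)
        entry-prefix g c<S c̃<S (k , 1F) k≺m =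
          bit-high-cong (col (low g) (high g)) (before⇒> m<n k≺m) c̃<S 0<S

        entry-suffix : ∀ c c̃ z → ¬ z ≺ variable-x → entry c c̃ g z ≡ entry c c̃ g′ z
        entry-suffix c c̃ (k , 0F) k⊀m =
          bit-low-cong c (high g) (high g′) (¬before⇒≤ m<n k⊀m)
        entry-suffix c c̃ (k , 1F) k⊀m =
          bit-low-cong c̃ (col (low g) (high g)) (col (low g′) (high g′)) (¬before⇒≤ m<n k⊀m)

        sameBlock : ∀ {c c̃} → c < S → c̃ < S →
                    onVars f (entry c c̃ g) ≡ onVars f (entry c c̃ g′)
        sameBlock {c} {c̃} c<S c̃<S = same (entry c c̃ g) (entry c c̃ g′)
          (entry-prefix g c<S c̃<S) (entry-prefix g′ c<S c̃<S) (entry-suffix c c̃)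

      -- Equal labels force equal levels, so only prefixes of one level remain to be distinguished.
      separated : ∀ s t → var s ≡ var t → Confused s t → s ≡ t
      separated (e , g) (e′ , g′) eq same with e≡e′
        where
        e≡e′ : e ≡ e′
        e≡e′ = toℕ-injective (+-cancelˡ-≡ d (toℕ e) (toℕ e′) (begin
          d + toℕ e                 ≡⟨ toℕ-fromℕ< (AtLevel.m<n e) ⟨
          toℕ (proj₁ (var (e , g)))    ≡⟨ cong (toℕ ∘ proj₁) eq ⟩
          toℕ (proj₁ (var (e′ , g′)))  ≡⟨ toℕ-fromℕ< (AtLevel.m<n e′) ⟩
          d + toℕ e′                ∎))
      ... | refl = cong (e ,_) (separated-at e g g′ same)

  -- The number of bits is a variable here so that it can be ⌈log₂ N⌉ for an abstract N.
  lowerBound-≡ : ∀ {l} → l ≡ suc (suc κ) →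
    1 ≤ d → d + d ≤ suc w → l ≤ 2 ^ d → (f : Vector Bool l → Vector Bool l → Bool) →
    (∀ {u v} → u < H → H ≤ v → v < 2 * H → f (bits l u) (bits l v) ≡ (v ≤ᵇ lastNeighbour u)) →
    ∀ (B : OBDD (interleavedOrder l)) → OBDD.Represents B (onVars f) → d * 2 ^ κ ≤ OBDD.#inner B
  lowerBound-≡ refl 1≤d 2d≤1+w n≤2^d f f≡ = lowerBound 1≤d 2d≤1+w n≤2^d f f≡

  hardGraph : ∀ {N} → N ≡ 2 ^ ⌈log₂ N ⌉ →
    ⌈log₂ N ⌉ ≡ suc (suc κ) → 1 ≤ d → d + d ≤ suc w → ⌈log₂ N ⌉ ≤ 2 ^ d → ⌈log₂ N ⌉ ≤ d * 8 →
    Σ[ G ∈ IntervalGraph N ] (LabeledByLeftEndpoints G ×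
      (∀ (B : OBDD (interleavedOrder ⌈log₂ N ⌉)) → OBDD.Represents B (onVars (χE G)) →
        N * ⌈log₂ N ⌉ ≤ OBDD.size B * 32))
  hardGraph {N} N≡2^n n≡2+κ 1≤d 2d≤1+w n≤2^d n≤8d = graph , labeled , bound
    where
    open FromLastNeighbour {N} lastNeighbour (λ u _ → ≤lastNeighbour u)
    n = ⌈log₂ N ⌉

    N≡2H : N ≡ 2 * H
    N≡2H = trans N≡2^n (cong (2 ^_) n≡2+κ)

    χE-bits : ∀ {u v} → u < H → H ≤ v → v < 2 * H →
              χE graph (bits n u) (bits n v) ≡ (v ≤ᵇ lastNeighbour u)
    χE-bits {u} {v} u<H H≤v v<2H = χE-< (∣bits∣ n (subst (u <_) N≡2^n (<-trans u<v v<N)))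
                                         (∣bits∣ n (subst (v <_) N≡2^n v<N)) u<v v<N
      where
      u<v = <-≤-trans u<H H≤v
      v<N = subst (v <_) (sym N≡2H) v<2H

    bound : ∀ (B : OBDD (interleavedOrder n)) → OBDD.Represents B (onVars (χE graph)) →
            N * n ≤ OBDD.size B * 32
    bound B represents = begin
      -- The factor 32 is 4 times 8: `N` is four times `2 ^ κ`, and `n` is at most `d * 8`.
      N * n                        ≤⟨ *-mono-≤ (≤-reflexive N≡2H) n≤8d ⟩
      2 * (2 * 2 ^ κ) * (d * 8)    ≡⟨ shape (2 ^ κ) d ⟩
      d * 2 ^ κ * 32               ≤⟨ *-monoˡ-≤ 32 (≤-trans
                                        (lowerBound-≡ n≡2+κ 1≤d 2d≤1+w n≤2^d (χE graph)
                                           χE-bits B represents)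
                                        (m≤m+n (OBDD.#inner B) 2)) ⟩
      OBDD.size B * 32             ∎
      where
      open ≤-Reasoning
      shape : ∀ x d → 2 * (2 * x) * (d * 8) ≡ d * x * 32
      shape = solve-∀

mainTheorem3 : ∃[ c ] ∃[ N₀ ] (0ℚ ℚ.< c ×
    (∀ N → N₀ ≤ N → ∃[ k ] (N ≡ 2 ^ k) →
    Σ[ G ∈ IntervalGraph N ]
    (LabeledByLeftEndpoints G ×
    (∀ (B : OBDD (interleavedOrder ⌈log₂ N ⌉)) →
    OBDD.Represents B (onVars (χE G)) →
    c ℚ.* ℕ→ℚ (N * ⌈log₂ N ⌉) ℚ.≤ ℕ→ℚ (OBDD.size B)))))
mainTheorem3 = c , 2 ^ 21 , ℚ.positive⁻¹ c , graphs
  where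
  -- This is 1/32, as `mkℚ` stores the denominator minus one.
  c = mkℚ (ℤ.+ 1) 31 (1-coprimeTo 32)

  graphs : ∀ N → 2 ^ 21 ≤ N → ∃[ k ] (N ≡ 2 ^ k) →
    Σ[ G ∈ IntervalGraph N ] (LabeledByLeftEndpoints G ×
      (∀ (B : OBDD (interleavedOrder ⌈log₂ N ⌉)) → OBDD.Represents B (onVars (χE G)) →
        c ℚ.* ℕ→ℚ (N * ⌈log₂ N ⌉) ℚ.≤ ℕ→ℚ (OBDD.size B)))
  graphs N 2^21≤N (k , N≡2^k) =
    let d , w , n≡2+κ , 1≤d , 2d≤1+w , n≤2^d , n≤8d = parameters 21≤n
        G , labeled , bound = Hardness.hardGraph d w N≡2^n n≡2+κ 1≤d 2d≤1+w n≤2^d n≤8d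
    in G , labeled , λ B represents → 1/-*-≤ 31 (OBDD.size B) (bound B represents)
    where
    k≡n : k ≡ ⌈log₂ N ⌉
    k≡n = trans (sym (⌈log₂2^n⌉≡n k)) (cong ⌈log₂_⌉ (sym N≡2^k))
    N≡2^n : N ≡ 2 ^ ⌈log₂ N ⌉
    N≡2^n = trans N≡2^k (cong (2 ^_) k≡n)
    21≤n : 21 ≤ ⌈log₂ N ⌉
    21≤n = 2^-cancel-≤ 21 ⌈log₂ N ⌉ (≤-trans 2^21≤N (≤-reflexive N≡2^n))
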